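{- Let $k$ be a non-negative integer and let $G$ be a finite simple graph. Suppose that for every induced subgraph $H$ of $G$ there exists a set $Y \subseteq V(H)$ with $|Y| \le k$ such that $H - Y$ is half-stable. Then the chromatic number of $G$ satisfies $\chi(G) \le k+2$.
   Context: For a graph $H$, $\alpha(H)$ denotes the independence number of $H$ (the maximum size of a set of pairwise non-adjacent vertices), and $\chi(H)$ denotes its chromatic number. For $Y \subseteq V(H)$, $H - Y$ is the subgraph of $H$ induced by $V(H)\setminus Y$. A graph $F$ is called half-stable if $\alpha(F) \ge \frac{1}{2}|V(F)|$, i.e. its independence ratio $\alpha(F)/|V(F)|$ is at least $\frac12$ (the graph with no vertices is regarded as half-stable). Equivalently, the conclusion states $\chi(G) \le \max_{H} \big(|V(H)| - 2\alpha(H) + 2\big)$, the maximum taken over all induced subgraphs $H$ of $G$ (including the graph with no vertices). -}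

module Defs where

open import Data.Nat using (ℕ; _≤_; _+_; _*_)
open import Data.Fin using (Fin)
open import Data.Fin.Subset using (Subset; _∈_; _⊆_; _─_; ∣_∣)
open import Data.Product using (Σ; _×_)
open import Relation.Nullary using (¬_)
open import Relation.Binary.PropositionalEquality using (_≡_)

record Graph (n : ℕ) : Set₁ where
  field
    Adj   : Fin n → Fin n → Set
    irrefl : ∀ v → ¬ Adj v v
    sym   : ∀ {u v} → Adj u v → Adj v u
open Graph public

Independent : ∀ {n} → Graph n → Subset n → Set
Independent G S = ∀ u v → u ∈ S → v ∈ S → ¬ Adj G u v

-- The induced subgraph G[S] is half-stable: α(G[S]) ≥ |S|/2, i.e. there is an
-- independent set I ⊆ S with 2|I| ≥ |S|.  (Empty S is half-stable via I = ∅.)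
HalfStable : ∀ {n} → Graph n → Subset n → Set
HalfStable {n} G S =
  Σ (Subset n) λ I → I ⊆ S × Independent G I × ∣ S ∣ ≤ 2 * ∣ I ∣

ProperColouring : ∀ {n} → Graph n → (m : ℕ) → (Fin n → Fin m) → Set
ProperColouring G m c = ∀ u v → Adj G u v → ¬ (c u ≡ c v)

ColourableWith : ∀ {n} → Graph n → ℕ → Set
ColourableWith {n} G m = Σ (Fin n → Fin m) (ProperColouring G m)

{-# OPTIONS --safe #-}
-- The hypothesis says |H| ≤ k + 2 α(H) for every induced subgraph H; call such a graph good. Induct on the
-- number of vertices. Contracting the two sides of an even cycle, both sides stable, to the two ends of an
-- edge keeps a graph good, because a stable set of a 2q-cycle has at most q vertices, and exactly q only if
-- it is a side. Deleting a vertex x and identifying two non-adjacent neighbours of x also keeps it good.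
-- Take a stable set I with |V| ≤ k + 2|I| and a (k+2)-colouring of the rest J. If I together with some
-- colour class of J spans a cycle, contract it. Otherwise all these bipartite graphs are forests, so there
-- are at most (k+2)|I| + |J| − (k+2) < (k+3)|I| edges between I and J, and some x ∈ I has degree at most
-- k+2. If two neighbours of x are non-adjacent, delete x and identify them: the neighbours of x then miss
-- a colour. If the neighbours of x form a clique, goodness bounds its size by k+1.
module Submission where

open import Defs hiding (sym)
open import Data.Empty using (⊥; ⊥-elim)
open import Data.Fin.Base using (Fin; zero; suc; toℕ; fromℕ<)
open import Data.Fin.Properties using (toℕ<n; toℕ-injective; suc-injective) renaming (_≟_ to _≟ꟳ_)
open import Data.Fin.Subset using (Subset; _─_; ∣_∣; inside; outside) renaming (_∈_ to _∈ˢ_)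
open import Data.Fin.Subset.Properties using (anySubset?; p─q⊆p; x∈p∧x∉q⇒x∈p─q) renaming (_∈?_ to _∈ˢ?_)
open import Data.List.Base using (List; []; _∷_; [_]; _++_; length; map; filter; cartesianProduct; allFin)
import Data.List.Membership.DecPropositional as DecMembership
open import Data.List.Membership.Propositional using (_∈_; _∉_; find; lose)
open import Data.List.Membership.Propositional.Properties using (∈-++⁺ˡ; ∈-++⁺ʳ; ∈-++⁻; ∈-∃++; ∈-filter⁺; ∈-filter⁻; ∈-map⁺; ∈-map⁻; ∈-cartesianProduct⁺; ∈-cartesianProduct⁻; ∈-allFin)
open import Data.List.Properties using (length-++; length-++-sucʳ; length-map; length-filter; length-tabulate; map-++; ++-assoc)
open import Data.List.Relation.Unary.All as All using ([]; _∷_)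
import Data.List.Relation.Unary.All.Properties as All
open import Data.List.Relation.Unary.AllPairs using ([]; _∷_)
open import Data.List.Relation.Unary.Any using (Any; here; there; any?)
open import Data.List.Relation.Unary.Any.Properties using (¬Any[])
open import Data.List.Relation.Unary.Unique.Propositional using (Unique)
open import Data.List.Relation.Unary.Unique.Propositional.Properties as Unique using (Unique[x∷xs]⇒x∉xs)
open import Data.Nat using (ℕ; zero; suc; _≤_; _<_; _+_; _*_; z≤n; s≤s; s≤s⁻¹)
open import Data.Nat.Properties hiding (_≟_; suc-injective)
open import Data.Nat.Properties using () renaming (_≟_ to _≟ℕ_)
open import Data.Nat.Tactic.RingSolver using (solve-∀)
open import Data.Product using (Σ; ∃; ∃₂; _×_; _,_; proj₁; proj₂)
open import Data.Sum.Base as Sum using (_⊎_; inj₁; inj₂)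
open import Data.Vec.Base as Vec using ([]; _∷_)
open import Data.Vec.Properties using (lookup∘tabulate; lookup⇒[]=; []=⇒lookup)
open import Function.Base using (_∘_)
open import Relation.Binary.Definitions using (DecidableEquality)
open import Relation.Binary.PropositionalEquality using (_≡_; _≢_; refl; sym; trans; cong; cong₂; subst)
open import Relation.Nullary using (¬_; Dec; yes; no; ¬?; does)
open import Relation.Nullary.Decidable using (_×-dec_; dec-true)

-- Duplicate-free lists as finite sets, and the pigeonhole principle.

module _ {A : Set} where
  open import Data.List.Relation.Binary.Subset.Propositional using (_⊆_)

  length-mono-⊆ : {xs ys : List A} → Unique xs → xs ⊆ ys → length xs ≤ length ys
  length-mono-⊆ {[]}     []       _   = z≤n
  length-mono-⊆ {x ∷ xs} u@(_ ∷ v) sub with ∈-∃++ (sub (here refl))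
  ... | as , bs , refl = ≤-trans (s≤s (length-mono-⊆ v sub′)) (≤-reflexive (sym (length-++-sucʳ as x bs)))
    where
    sub′ : xs ⊆ as ++ bs
    sub′ y∈xs with ∈-++⁻ as (sub (there y∈xs))
    ... | inj₁ y∈as           = ∈-++⁺ˡ y∈as
    ... | inj₂ (here refl)    = ⊥-elim (Unique[x∷xs]⇒x∉xs u y∈xs)
    ... | inj₂ (there y∈bs)   = ∈-++⁺ʳ as y∈bs

  Unique-++⁻ˡ : (xs : List A) {ys : List A} → Unique (xs ++ ys) → Unique xs
  Unique-++⁻ˡ []       _       = []
  Unique-++⁻ˡ (x ∷ xs) (p ∷ u) = All.++⁻ˡ xs p ∷ Unique-++⁻ˡ xs u

  Unique-∷ : {x : A} {xs : List A} → x ∉ xs → Unique xs → Unique (x ∷ xs)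
  Unique-∷ {x} {xs} x∉xs u = All.tabulate (λ y∈xs x≡y → x∉xs (subst (_∈ xs) (sym x≡y) y∈xs)) ∷ u

module _ where
  open import Data.List.Relation.Binary.Subset.Propositional using (_⊆_)

  fresh : ∀ {m} (L : List (Fin m)) → length L < m → ∃ λ i → i ∉ L
  fresh {m} L L<m with any? (λ i → ¬? (DecMembership._∈?_ _≟ꟳ_ i L)) (allFin m)
  ... | yes some = let i , _ , i∉L = find some in i , i∉L
  ... | no  none = ⊥-elim (<⇒≱ L<m (subst (_≤ length L) (length-tabulate {n = m} (λ i → i))
                    (length-mono-⊆ (Unique.allFin⁺ m) all-seen)))
    where
    all-seen : allFin m ⊆ L
    all-seen {i} i∈ with DecMembership._∈?_ _≟ꟳ_ i L
    ... | yes p = p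
    ... | no  p = ⊥-elim (none (lose i∈ p))

-- Decidable graphs, goodness, trails and even cycles.

record DecGraph (V : Set) : Set₁ where
  field
    _~_  : V → V → Set
    _~?_ : ∀ u v → Dec (u ~ v)
    ~-sym : ∀ {u v} → u ~ v → v ~ u
    ~-irr : ∀ {v} → ¬ (v ~ v)

module Colour {V : Set} (_≟_ : DecidableEquality V) where

  open import Data.List.Membership.DecPropositional _≟_ using (_∈?_)
  open import Data.List.Relation.Binary.Subset.Propositional using (_⊆_)

  infixl 6 _∖_
  _∖_ : List V → List V → List V
  xs ∖ ys = filter (λ v → ¬? (v ∈? ys)) xs

  ∈-∖⁺ : ∀ {v xs ys} → v ∈ xs → v ∉ ys → v ∈ xs ∖ ys
  ∈-∖⁺ = ∈-filter⁺ (λ v → ¬? (v ∈? _))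

  ∈-∖⁻ : ∀ {v} xs {ys} → v ∈ xs ∖ ys → v ∈ xs × v ∉ ys
  ∈-∖⁻ xs = ∈-filter⁻ (λ v → ¬? (v ∈? _)) {xs = xs}

  ∖-unique : ∀ {xs ys} → Unique xs → Unique (xs ∖ ys)
  ∖-unique = Unique.filter⁺ (λ v → ¬? (v ∈? _))

  length-∖-⊆ : ∀ {xs ys} → Unique xs → Unique ys → ys ⊆ xs → length (xs ∖ ys) + length ys ≤ length xs
  length-∖-⊆ {xs} {ys} u v sub =
    ≤-trans (≤-reflexive (sym (length-++ (xs ∖ ys))))
      (length-mono-⊆ (Unique.++⁺ (∖-unique u) v (λ (p , q) → proj₂ (∈-∖⁻ xs p) q)) both)
    where
    both : (xs ∖ ys) ++ ys ⊆ xs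
    both p with ∈-++⁻ (xs ∖ ys) p
    ... | inj₁ q = proj₁ (∈-∖⁻ xs q)
    ... | inj₂ q = sub q

  module _ (G : DecGraph V) where
    open DecGraph G

    Stable : List V → Set
    Stable I = ∀ {u v} → u ∈ I → v ∈ I → ¬ (u ~ v)

    -- This is |H| ≤ k + 2α(H) for all induced subgraphs on vertices of `S`, with `I` witnessing
    -- α(H). Carrying a list `S` lets vertices be deleted while `V` and the graph stay fixed.
    Good : ℕ → List V → Set
    Good k S = ∀ H → Unique H → H ⊆ S →
      ∃ λ I → Unique I × I ⊆ H × Stable I × length H ≤ k + (length I + length I)

    Colourable : ℕ → List V → Set
    Colourable m S = ∃ λ (c : V → Fin m) → ∀ {u v} → u ∈ S → v ∈ S → u ~ v → c u ≢ c v

    Stable-⊆ : ∀ {I J} → I ⊆ J → Stable J → Stable I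
    Stable-⊆ I⊆J st p q = st (I⊆J p) (I⊆J q)

    Good-⊆ : ∀ {k S T} → T ⊆ S → Good k S → Good k T
    Good-⊆ T⊆S good H u H⊆T = good H u (T⊆S ∘ H⊆T)

    -- Trail x z [(x₀,y₀),…,(xₘ,yₘ)] : x = x₀ ~ y₀ ~ x₁ ~ y₁ ~ … ~ xₘ ~ yₘ ~ z.
    data Trail : V → V → List (V × V) → Set where
      done : ∀ {z} → Trail z z []
      step : ∀ {x y x′ z ps} → x ~ y → y ~ x′ → Trail x′ z ps → Trail x z ((x , y) ∷ ps)

    -- `X` and `Y` are the two sides of an even cycle, met alternately by the closed trail. `longer`
    -- excludes the degenerate walk along one edge and back, so the cycle has at least four
    -- vertices.
    record StableCycle (S : List V) : Set where
      field
        x₀ y₀ : V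
        rest  : List (V × V)
      X : List V
      X = x₀ ∷ map proj₁ rest
      Y : List V
      Y = y₀ ∷ map proj₂ rest
      field
        longer   : 1 ≤ length rest
        trail    : Trail x₀ x₀ ((x₀ , y₀) ∷ rest)
        X-unique : Unique X
        Y-unique : Unique Y
        X⊆S      : X ⊆ S
        Y⊆S      : Y ⊆ S
        disjoint : ∀ {v} → v ∈ X → v ∉ Y
        X-stable : Stable X
        Y-stable : Stable Y

    -- How many vertices of a trail a stable set can contain.

    module _ {J : List V} (J-stable : Stable J) where

      -- The length of `L` serves as an upper bound for the number of trail vertices in `J`, so that
      -- this number itself is never computed.
      Covers : List V → List (V × V) → Set
      Covers L ps = ∀ {v} → v ∈ J → v ∈ map proj₁ ps ⊎ v ∈ map proj₂ ps → v ∈ L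

      Covers-skip : ∀ {L x y ps} → x ∉ J → y ∉ J → Covers L ps → Covers L ((x , y) ∷ ps)
      Covers-skip x∉ y∉ cov v∈J (inj₁ (here refl)) = ⊥-elim (x∉ v∈J)
      Covers-skip x∉ y∉ cov v∈J (inj₁ (there p))   = cov v∈J (inj₁ p)
      Covers-skip x∉ y∉ cov v∈J (inj₂ (here refl)) = ⊥-elim (y∉ v∈J)
      Covers-skip x∉ y∉ cov v∈J (inj₂ (there p))   = cov v∈J (inj₂ p)

      -- A stable set contains at most one end of an edge, so one vertex accounts for the whole
      -- pair.
      Covers-pick : ∀ {L x y ps} → x ~ y → Covers L ps → ∃ λ w → Covers (w ∷ L) ((x , y) ∷ ps)
      Covers-pick {x = x} {y} x~y cov with x ∈? J
      ... | yes x∈J = x , λ where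
        _   (inj₁ (here refl)) → here refl
        v∈J (inj₁ (there p))   → there (cov v∈J (inj₁ p))
        v∈J (inj₂ (here refl)) → ⊥-elim (J-stable x∈J v∈J x~y)
        v∈J (inj₂ (there p))   → there (cov v∈J (inj₂ p))
      ... | no x∉J = y , λ where
        v∈J (inj₁ (here refl)) → ⊥-elim (x∉J v∈J)
        v∈J (inj₁ (there p))   → there (cov v∈J (inj₁ p))
        _   (inj₂ (here refl)) → here refl
        v∈J (inj₂ (there p))   → there (cov v∈J (inj₂ p))

      Loose Short : List (V × V) → Set
      Loose ps = ∃ λ L → length L ≤ length ps × Covers L ps
      Short ps = ∃ λ L → length L < length ps × Covers L ps

      trail-loose : ∀ {x z ps} → Trail x z ps → Loose ps
      trail-loose done = [] , z≤n , λ where _ (inj₁ ()) ; _ (inj₂ ())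
      trail-loose (step x~y _ t) with trail-loose t
      ... | L , len , cov = _ , s≤s len , proj₂ (Covers-pick x~y cov)

      Short-∷ : ∀ {x y ps} → x ~ y → Short ps → Short ((x , y) ∷ ps)
      Short-∷ x~y (L , len , cov) = _ , s≤s len , proj₂ (Covers-pick x~y cov)

      -- If `y` is also outside `J`, the first pair contributes nothing and one vertex is saved. If
      -- `y` is in `J`, stability keeps the next `x′` outside, and the argument repeats.
      trail-from-∉ : ∀ {x z ps} → Trail x z ps → x ∉ J → Short ps ⊎ (map proj₂ ps ⊆ J × z ∉ J)
      trail-from-∉ done x∉J = inj₂ ((λ ()) , x∉J)
      trail-from-∉ (step {y = y} x~y y~x′ t) x∉J with y ∈? J
      ... | no y∉J = let L , len , cov = trail-loose t in
                     inj₁ (L , s≤s len , Covers-skip x∉J y∉J cov)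
      ... | yes y∈J with trail-from-∉ t (λ x′∈J → J-stable y∈J x′∈J y~x′)
      ...   | inj₁ short        = inj₁ (Short-∷ x~y short)
      ...   | inj₂ (sub , z∉J) = inj₂ ((λ where (here refl) → y∈J ; (there p) → sub p) , z∉J)

      -- From the first `x` outside `J` onwards, `trail-from-∉` applies and either saves a vertex or
      -- carries non-membership through to `z`.
      trail-dichotomy : ∀ {x z ps} → Trail x z ps → Short ps ⊎ map proj₁ ps ⊆ J ⊎ z ∉ J
      trail-dichotomy done = inj₂ (inj₁ λ ())
      trail-dichotomy t@(step {x} x~y _ t′) with x ∈? J
      ... | no x∉J with trail-from-∉ t x∉J
      ...   | inj₁ short       = inj₁ short
      ...   | inj₂ (_ , z∉J)  = inj₂ (inj₂ z∉J)
      trail-dichotomy t@(step {x} x~y _ t′) | yes x∈J with trail-dichotomy t′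
      ...   | inj₁ short       = inj₁ (Short-∷ x~y short)
      ...   | inj₂ (inj₁ sub) = inj₂ (inj₁ λ where (here refl) → x∈J ; (there p) → sub p)
      ...   | inj₂ (inj₂ z∉J) = inj₂ (inj₂ z∉J)

      -- On a closed trail the end is also the start, so an end outside `J` allows a second pass
      -- with `trail-from-∉` from the beginning. Thus a stable set that saves no vertex contains a
      -- full side.
      cycle-trichotomy : ∀ {x ps} → Trail x x ps → Short ps ⊎ map proj₁ ps ⊆ J ⊎ map proj₂ ps ⊆ J
      cycle-trichotomy t with trail-dichotomy t
      ... | inj₁ short       = inj₁ short
      ... | inj₂ (inj₁ sub) = inj₂ (inj₁ sub)
      ... | inj₂ (inj₂ x∉J) with trail-from-∉ t x∉J
      ...   | inj₁ short      = inj₁ short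
      ...   | inj₂ (sub , _) = inj₂ (inj₂ sub)

  -- The arithmetic by which goodness descends to a quotient: lifting a vertex set adds `2p`
  -- vertices, and bringing the stable set back down costs at most `p`.
  cancel-twice : ∀ h r p k {i j} → h + (r + (p + p)) ≤ k + (i + i) → i ≤ j + p → h + r ≤ k + (j + j)
  cancel-twice h r p k {i} {j} le i≤ = +-cancelʳ-≤ (p + p) (h + r) (k + (j + j)) (begin
    h + r + (p + p)            ≡⟨ +-assoc h r (p + p) ⟩
    h + (r + (p + p))          ≤⟨ le ⟩
    k + (i + i)                ≤⟨ +-monoʳ-≤ k (+-mono-≤ i≤ i≤) ⟩
    k + ((j + p) + (j + p))    ≡⟨ shuffle k j p ⟩
    k + (j + j) + (p + p)      ∎)
    where
    open ≤-Reasoning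
    shuffle : ∀ k j p → k + ((j + p) + (j + p)) ≡ k + (j + j) + (p + p)
    shuffle = solve-∀

  -- Quotients of a graph by a map with stable fibres.

  module Quotient (G : DecGraph V) (S : List V) (π : V → V)
                  (fibre-stable : ∀ {u v} → u ∈ S → v ∈ S → π u ≡ π v → ¬ DecGraph._~_ G u v) where
    open DecGraph G

    -- The quotient keeps the vertex type `V`, each class being named by its value under `π`.
    -- Searching for representatives in the list `S` keeps adjacency decidable.
    _~/_ : V → V → Set
    u ~/ v = Any (λ u′ → π u′ ≡ u × Any (λ v′ → π v′ ≡ v × u′ ~ v′) S) S

    ~/-intro : ∀ {u v} → u ∈ S → v ∈ S → u ~ v → π u ~/ π v
    ~/-intro u∈S v∈S u~v = lose u∈S (refl , lose v∈S (refl , u~v))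

    ~/-elim : ∀ {u v} → u ~/ v → ∃₂ λ u′ v′ → u′ ∈ S × v′ ∈ S × π u′ ≡ u × π v′ ≡ v × u′ ~ v′
    ~/-elim e with find e
    ... | u′ , u′∈S , πu′ , e′ with find e′
    ... | v′ , v′∈S , πv′ , u′~v′ = u′ , v′ , u′∈S , v′∈S , πu′ , πv′ , u′~v′

    quotient : DecGraph V
    quotient = record
      { _~_   = _~/_
      ; _~?_  = λ u v → any? (λ u′ → (π u′ ≟ u) ×-dec any? (λ v′ → (π v′ ≟ v) ×-dec (u′ ~? v′)) S) S
      ; ~-sym = λ e → case-sym (~/-elim e)
      ; ~-irr = λ e → case-irr (~/-elim e)
      }
      where
      case-sym : ∀ {u v} → (∃₂ λ u′ v′ → u′ ∈ S × v′ ∈ S × π u′ ≡ u × π v′ ≡ v × u′ ~ v′) → v ~/ u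
      case-sym (_ , _ , u∈S , v∈S , refl , refl , u~v) = ~/-intro v∈S u∈S (~-sym u~v)
      case-irr : ∀ {v} → ¬ (∃₂ λ u′ v′ → u′ ∈ S × v′ ∈ S × π u′ ≡ v × π v′ ≡ v × u′ ~ v′)
      case-irr (_ , _ , u∈S , v∈S , pu , pv , u~v) = fibre-stable u∈S v∈S (trans pu (sym pv)) u~v

    -- An edge inside `I′` comes from an edge between representatives in `S`, and `lift` puts both
    -- of them in `I`.
    quotient-stable : ∀ {I I′} → Stable G I → (∀ {u} → u ∈ S → π u ∈ I′ → u ∈ I) → Stable quotient I′
    quotient-stable st lift p q e with ~/-elim e
    ... | _ , _ , u∈S , v∈S , refl , refl , u~v = st (lift u∈S p) (lift v∈S q) u~v

  -- Contracting an even cycle to an edge preserves goodness.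

  module _ {k : ℕ} {G : DecGraph V} {S : List V} (S-unique : Unique S) (good : Good G k S)
           (C : StableCycle G S) where
    open StableCycle C
    open DecGraph G

    private
      D : List V
      D = X ++ Y

      x₀∈X : x₀ ∈ X
      x₀∈X = here refl
      y₀∈Y : y₀ ∈ Y
      y₀∈Y = here refl

    collapse : V → V
    collapse v with v ∈? X | v ∈? Y
    ... | yes _ | _     = x₀
    ... | no  _ | yes _ = y₀
    ... | no  _ | no  _ = v

    collapse-∈X : ∀ {v} → collapse v ∈ X → v ∈ X
    collapse-∈X {v} p with v ∈? X | v ∈? Y
    ... | yes v∈X | _     = v∈X
    ... | no  _   | yes _ = ⊥-elim (disjoint p y₀∈Y)
    ... | no  _   | no  _ = p

    collapse-∈Y : ∀ {v} → collapse v ∈ Y → v ∈ Y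
    collapse-∈Y {v} p with v ∈? X | v ∈? Y
    ... | yes _   | _       = ⊥-elim (disjoint x₀∈X p)
    ... | no  _   | yes v∈Y = v∈Y
    ... | no  _   | no  _   = p

    collapse-∉ : ∀ {v} → collapse v ∉ D → collapse v ≡ v
    collapse-∉ {v} p with v ∈? X | v ∈? Y
    ... | yes _   | _     = ⊥-elim (p (∈-++⁺ˡ x₀∈X))
    ... | no  _   | yes _ = ⊥-elim (p (∈-++⁺ʳ X y₀∈Y))
    ... | no  _   | no  _ = refl

    fibre : ∀ {u v} → u ∈ S → v ∈ S → collapse u ≡ collapse v → ¬ (u ~ v)
    fibre {u} {v} _ _ eq u~v with collapse u ∈? X | collapse u ∈? Y
    ... | yes p | _     = X-stable (collapse-∈X p) (collapse-∈X (subst (_∈ X) eq p)) u~v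
    ... | no  _ | yes p = Y-stable (collapse-∈Y p) (collapse-∈Y (subst (_∈ Y) eq p)) u~v
    ... | no  p | no  q = ~-irr (subst (_~ v) u≡v u~v)
      where
      ∉D : collapse u ∉ D
      ∉D r with ∈-++⁻ X r
      ... | inj₁ r′ = p r′
      ... | inj₂ r′ = q r′
      u≡v : u ≡ v
      u≡v = trans (sym (collapse-∉ ∉D)) (trans eq (collapse-∉ (subst (_∉ D) eq ∉D)))

    open Quotient G S collapse fibre

    contracted : List V
    contracted = x₀ ∷ y₀ ∷ (S ∖ D)

    D-unique : Unique D
    D-unique = Unique.++⁺ X-unique Y-unique (λ (p , q) → disjoint p q)

    D⊆S : D ⊆ S
    D⊆S p with ∈-++⁻ X p
    ... | inj₁ q = X⊆S q
    ... | inj₂ q = Y⊆S q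

    ∉∖D : ∀ {v} → v ∈ D → v ∉ S ∖ D
    ∉∖D v∈D v∈ = proj₂ (∈-∖⁻ S v∈) v∈D

    contracted-unique : Unique contracted
    contracted-unique = Unique-∷ x₀∉ (Unique-∷ (∉∖D (∈-++⁺ʳ X y₀∈Y)) (∖-unique S-unique))
      where
      x₀∉ : x₀ ∉ y₀ ∷ (S ∖ D)
      x₀∉ (here eq)  = disjoint x₀∈X (here eq)
      x₀∉ (there p) = ∉∖D (∈-++⁺ˡ x₀∈X) p

    contracted-shorter : length contracted < length S
    contracted-shorter = begin-strict
      2 + length (S ∖ D)          ≡⟨ +-comm 2 (length (S ∖ D)) ⟩
      length (S ∖ D) + 2          <⟨ +-monoʳ-< (length (S ∖ D)) (≤-trans (s≤s (s≤s (s≤s z≤n))) four) ⟩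
      length (S ∖ D) + length D   ≤⟨ length-∖-⊆ S-unique D-unique D⊆S ⟩
      length S                    ∎
      where
      open ≤-Reasoning
      -- By `longer` each side has at least two vertices; trading four or more for `x₀` and `y₀`
      -- makes the induction descend.
      four : 4 ≤ length D
      four = begin
        2 + 2                                         ≤⟨ +-mono-≤ (s≤s longer) (s≤s longer) ⟩
        suc (length rest) + suc (length rest)         ≡⟨ cong₂ (λ a b → suc a + suc b) (length-map proj₁ rest) (length-map proj₂ rest) ⟨
        length X + length Y                           ≡⟨ length-++ X ⟨
        length D                                      ∎

    contracted-colourable : ∀ {m} → Colourable quotient m contracted → Colourable G m S
    contracted-colourable (c , proper) = c ∘ collapse ,
      λ u∈S v∈S u~v → proper (collapse-∈ u∈S) (collapse-∈ v∈S) (~/-intro u∈S v∈S u~v)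
      where
      collapse-∈ : ∀ {v} → v ∈ S → collapse v ∈ contracted
      collapse-∈ {v} v∈S with v ∈? X | v ∈? Y
      ... | yes _ | _     = here refl
      ... | no  _ | yes _ = there (here refl)
      ... | no  p | no  q = there (there (∈-∖⁺ v∈S ∉D))
        where
        ∉D : v ∉ D
        ∉D r with ∈-++⁻ X r
        ... | inj₁ r′ = p r′
        ... | inj₂ r′ = q r′

    module _ (H : List V) (H-unique : Unique H) (H⊆ : H ⊆ contracted) where

      private
        K : List V
        K = H ∖ (x₀ ∷ y₀ ∷ [])

        K⊆ : K ⊆ S ∖ D
        K⊆ p with ∈-∖⁻ H p
        ... | v∈H , v∉ with H⊆ v∈H
        ...   | here refl         = ⊥-elim (v∉ (here refl))
        ...   | there (here refl) = ⊥-elim (v∉ (there (here refl)))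
        ...   | there (there q)   = q

      Conclusion : Set
      Conclusion = ∃ λ I → Unique I × I ⊆ H × Stable quotient I × length H ≤ k + (length I + length I)

      -- With p = `length rest`, the at most `r` ends of the contracted edge in `H` are replaced by
      -- the `r + 2p` cycle vertices `F`. A stable set `I` of `K ++ F` either has at most p vertices
      -- on the cycle, and these are dropped, or contains a side, which is traded for its end. The
      -- last two hypotheses ensure that this end lies in `H`.
      expand : ∀ F r → Unique F → F ⊆ D → length H ≤ length K + r →
               length F ≡ r + (length rest + length rest) →
               (x₀ ∈ F → x₀ ∈ H) → (y₀ ∈ F → y₀ ∈ H) → Conclusion
      expand F r F-unique F⊆D H≤ F≡ x₀F y₀F
        with good (K ++ F) (Unique.++⁺ (∖-unique H-unique) F-unique (λ (p , q) → ∉∖D (F⊆D q) (K⊆ p))) sub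
        where
        sub : K ++ F ⊆ S
        sub p with ∈-++⁻ K p
        ... | inj₁ q = proj₁ (∈-∖⁻ S (K⊆ q))
        ... | inj₂ q = D⊆S (F⊆D q)
      ... | I , I-unique , I⊆ , I-stable , le = conclude (cycle-trichotomy G I-stable trail)
        where
        I₀ : List V
        I₀ = I ∖ D

        I₀⊆K : I₀ ⊆ K
        I₀⊆K p with ∈-∖⁻ I p
        ... | v∈I , v∉D with ∈-++⁻ K (I⊆ v∈I)
        ...   | inj₁ q = q
        ...   | inj₂ q = ⊥-elim (v∉D (F⊆D q))

        I₀⊆H : I₀ ⊆ H
        I₀⊆H p = proj₁ (∈-∖⁻ H (I₀⊆K p))

        I∩D⊆F : ∀ {v} → v ∈ D → v ∈ I → v ∈ F
        I∩D⊆F v∈D v∈I with ∈-++⁻ K (I⊆ v∈I)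
        ... | inj₁ q = ⊥-elim (∉∖D v∈D (K⊆ q))
        ... | inj₂ q = q

        I-length : ∀ {L} → Covers G I-stable L ((x₀ , y₀) ∷ rest) → length I ≤ length I₀ + length L
        I-length {L} cov = ≤-trans (length-mono-⊆ I-unique split) (≤-reflexive (length-++ I₀))
          where
          split : I ⊆ I₀ ++ L
          split {v} v∈I with v ∈? D
          ... | no  v∉D = ∈-++⁺ˡ (∈-∖⁺ v∈I v∉D)
          ... | yes v∈D = ∈-++⁺ʳ I₀ (cov v∈I (∈-++⁻ X v∈D))

        le′ : length K + (r + (length rest + length rest)) ≤ k + (length I + length I)
        le′ = subst (λ n → length K + n ≤ k + (length I + length I)) F≡
                (≤-trans (≤-reflexive (sym (length-++ K))) le)

        bound : ∀ {j} → length I ≤ j + length rest → length H ≤ k + (j + j)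
        bound i≤ = ≤-trans H≤ (cancel-twice (length K) r (length rest) k le′ i≤)

        lift₀ : ∀ {u} → u ∈ S → collapse u ∈ I₀ → u ∈ I
        lift₀ u∈S p with ∈-∖⁻ I p
        ... | q , ∉D = subst (_∈ I) (collapse-∉ ∉D) q

        -- Up to `suc (length rest)` cycle vertices of `I` are lost here, but `z` makes up for one
        -- of them.
        add : ∀ {z} → z ∈ D → z ∈ H → (∀ {u} → u ∈ S → collapse u ≡ z → u ∈ I) → Conclusion
        add {z} z∈D z∈H lift =
          z ∷ I₀ , Unique-∷ (λ p → proj₂ (∈-∖⁻ I p) z∈D) (∖-unique I-unique) ,
          (λ where (here refl) → z∈H ; (there p) → I₀⊆H p) ,
          quotient-stable I-stable (λ where u∈S (here eq) → lift u∈S eq ; u∈S (there p) → lift₀ u∈S p) ,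
          bound (≤-trans (I-length cov) (≤-trans (+-monoʳ-≤ (length I₀) len) (≤-reflexive (+-suc (length I₀) (length rest)))))
          where
          loose = trail-loose G I-stable trail
          len = proj₁ (proj₂ loose)
          cov = proj₂ (proj₂ loose)

        conclude : Short G I-stable ((x₀ , y₀) ∷ rest) ⊎ X ⊆ I ⊎ Y ⊆ I → Conclusion
        conclude (inj₁ (L , s≤s len , cov)) =
          I₀ , ∖-unique I-unique , I₀⊆H , quotient-stable I-stable lift₀ ,
          bound (≤-trans (I-length cov) (+-monoʳ-≤ (length I₀) len))
        conclude (inj₂ (inj₁ X⊆I)) =
          add (∈-++⁺ˡ x₀∈X) (x₀F (I∩D⊆F (∈-++⁺ˡ x₀∈X) (X⊆I x₀∈X)))
            (λ _ eq → X⊆I (collapse-∈X (here eq)))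
        conclude (inj₂ (inj₂ Y⊆I)) =
          add (∈-++⁺ʳ X y₀∈Y) (y₀F (I∩D⊆F (∈-++⁺ʳ X y₀∈Y) (Y⊆I y₀∈Y)))
            (λ _ eq → Y⊆I (collapse-∈Y (here eq)))

      private
        length-H : ∀ L → (∀ {v} → v ∈ H → v ∈ x₀ ∷ y₀ ∷ [] → v ∈ L) → length H ≤ length K + length L
        length-H L ends = ≤-trans (length-mono-⊆ H-unique sub) (≤-reflexive (length-++ K))
          where
          sub : H ⊆ K ++ L
          sub {v} v∈H with v ∈? (x₀ ∷ y₀ ∷ [])
          ... | yes p = ∈-++⁺ʳ K (ends v∈H p)
          ... | no  p = ∈-++⁺ˡ (∈-∖⁺ v∈H p)

        length-rests : ∀ (xs ys : List V) → length xs ≡ length rest → length ys ≡ length rest →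
                       length (xs ++ ys) ≡ length rest + length rest
        length-rests xs ys p q = trans (length-++ xs) (cong₂ _+_ p q)

        X′ = map proj₁ rest
        Y′ = map proj₂ rest

        X′-length : length X′ ≡ length rest
        X′-length = length-map proj₁ rest
        Y′-length : length Y′ ≡ length rest
        Y′-length = length-map proj₂ rest

        tail-unique : ∀ {x : V} {xs} → Unique (x ∷ xs) → Unique xs
        tail-unique (_ ∷ u) = u

      contracted-stable : Conclusion
      contracted-stable with x₀ ∈? H | y₀ ∈? H
      ... | yes x∈ | yes y∈ =
        expand (X ++ Y) 2 D-unique (λ p → p) (length-H (x₀ ∷ y₀ ∷ []) λ _ p → p)
          (cong suc (trans (length-++ X′) (trans (cong₂ (λ a b → a + suc b) X′-length Y′-length) (+-suc _ _))))
          (λ _ → x∈) (λ _ → y∈)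
      -- Leaving `y₀` out of `F` prevents `I` from containing all of `Y`, so the absent end is never
      -- called for.
      ... | yes x∈ | no  y∉ =
        expand (X ++ Y′) 1
          (Unique.++⁺ X-unique (tail-unique Y-unique) (λ (p , q) → disjoint p (there q)))
          (λ p → Sum.[ ∈-++⁺ˡ , (λ q → ∈-++⁺ʳ X (there q)) ]′ (∈-++⁻ X p))
          (length-H (x₀ ∷ []) λ where
            _ (here refl)           → here refl
            y∈ (there (here refl)) → ⊥-elim (y∉ y∈))
          (cong suc (length-rests X′ Y′ X′-length Y′-length))
          (λ _ → x∈)
          (λ p → ⊥-elim (Sum.[ (λ q → disjoint q y₀∈Y) , Unique[x∷xs]⇒x∉xs Y-unique ]′ (∈-++⁻ X p)))
      ... | no  x∉ | yes y∈ =
        expand (X′ ++ Y) 1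
          (Unique.++⁺ (tail-unique X-unique) Y-unique (λ (p , q) → disjoint (there p) q))
          (λ p → Sum.[ (λ q → ∈-++⁺ˡ (there q)) , ∈-++⁺ʳ X ]′ (∈-++⁻ X′ p))
          (length-H (y₀ ∷ []) λ where
            x∈ (here refl)         → ⊥-elim (x∉ x∈)
            _ (there (here refl)) → here refl)
          (trans (length-++ X′) (trans (cong₂ (λ a b → a + suc b) X′-length Y′-length) (+-suc _ _)))
          (λ p → ⊥-elim (Sum.[ Unique[x∷xs]⇒x∉xs X-unique , disjoint x₀∈X ]′ (∈-++⁻ X′ p)))
          (λ _ → y∈)
      -- Now `H` avoids the cycle, where `collapse` is the identity, so the stable set of `H` in `G`
      -- can be kept.
      ... | no  x∉ | no  y∉ with good H H-unique (λ p → proj₁ (∈-∖⁻ S (H⊆∖ p)))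
        where
        H⊆∖ : H ⊆ S ∖ D
        H⊆∖ p with H⊆ p
        ... | here refl         = ⊥-elim (x∉ p)
        ... | there (here refl) = ⊥-elim (y∉ p)
        ... | there (there q)   = q
      ...   | I , I-unique , I⊆H , I-stable , le =
        I , I-unique , I⊆H , quotient-stable I-stable lift , le
        where
        lift : ∀ {u} → u ∈ S → collapse u ∈ I → u ∈ I
        lift u∈S p with H⊆ (I⊆H p)
        ... | here eq          = ⊥-elim (x∉ (subst (_∈ H) eq (I⊆H p)))
        ... | there (here eq)  = ⊥-elim (y∉ (subst (_∈ H) eq (I⊆H p)))
        ... | there (there q) = subst (_∈ I) (collapse-∉ (proj₂ (∈-∖⁻ S q))) p

    contract-cycle : ∃₂ λ G′ S′ → Unique S′ × length S′ < length S × Good G′ k S′ ×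
                     (∀ {m} → Colourable G′ m S′ → Colourable G m S)
    contract-cycle = quotient , contracted , contracted-unique , contracted-shorter ,
                     contracted-stable , contracted-colourable

  -- Deleting a vertex and identifying two of its non-adjacent neighbours preserves goodness.

  module _ {k : ℕ} {G : DecGraph V} {S : List V} (S-unique : Unique S) (good : Good G k S) where
    open DecGraph G

    module _ {x a b : V} (x∈S : x ∈ S) (a∈S : a ∈ S) (b∈S : b ∈ S)
             (x~a : x ~ a) (x~b : x ~ b) (a≢b : a ≢ b) (a≁b : ¬ (a ~ b)) where

      private
        T : List V
        T = S ∖ (x ∷ [])

        rename : V → V
        rename v with v ≟ b
        ... | yes _ = a
        ... | no  _ = v

        rename-b : rename b ≡ a
        rename-b with b ≟ b
        ... | yes _ = refl
        ... | no  p = ⊥-elim (p refl)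

        rename-≢ : ∀ {v} → v ≢ b → rename v ≡ v
        rename-≢ {v} v≢b with v ≟ b
        ... | yes p = ⊥-elim (v≢b p)
        ... | no  _ = refl

        rename-≢a : ∀ {v} → rename v ≢ a → rename v ≡ v
        rename-≢a {v} p with v ≟ b
        ... | yes _ = ⊥-elim (p refl)
        ... | no  _ = refl

        fibre′ : ∀ {u v} → u ∈ T → v ∈ T → rename u ≡ rename v → ¬ (u ~ v)
        fibre′ {u} {v} _ _ eq u~v with u ≟ b | v ≟ b
        ... | yes refl | yes refl = ~-irr u~v
        ... | yes refl | no  _    = a≁b (subst (_~ b) (sym eq) (~-sym u~v))
        ... | no  _    | yes refl = a≁b (subst (_~ b) eq u~v)
        ... | no  _    | no  _    = ~-irr (subst (_~ v) eq u~v)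

      open Quotient G T rename fibre′

      private
        S′ : List V
        S′ = T ∖ (b ∷ [])

        -- If `a` is in `H`, goodness is applied to `H` with `x` and `b` added, and one vertex of
        -- the stable set `I` is given up. As `x` is adjacent to `a` and `b`, either `x` is the only
        -- one of the three that `I` may contain, or `x` is not in `I`. The merged vertex `a` is
        -- kept exactly when `I` contains both `a` and `b`.
        good′ : Good quotient k S′
        good′ H H-unique H⊆ with a ∈? H
        ... | no a∉H with good H H-unique (λ p → proj₁ (∈-∖⁻ S (proj₁ (∈-∖⁻ T (H⊆ p)))))
        ...   | I , I-unique , I⊆H , I-stable , le = I , I-unique , I⊆H , quotient-stable I-stable lift , le
          where
          lift : ∀ {u} → u ∈ T → rename u ∈ I → u ∈ I
          lift _ p = subst (_∈ I) (rename-≢a (λ eq → a∉H (subst (_∈ H) eq (I⊆H p)))) p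
        good′ H H-unique H⊆ | yes a∈H with good (x ∷ b ∷ H) H⁺-unique H⁺⊆
          where
          x∉H : x ∉ H
          x∉H p = proj₂ (∈-∖⁻ S (proj₁ (∈-∖⁻ T (H⊆ p)))) (here refl)
          b∉H : b ∉ H
          b∉H p = proj₂ (∈-∖⁻ T (H⊆ p)) (here refl)
          x∉ : x ∉ b ∷ H
          x∉ (here refl) = ~-irr x~b
          x∉ (there p)   = x∉H p
          H⁺-unique : Unique (x ∷ b ∷ H)
          H⁺-unique = Unique-∷ x∉ (Unique-∷ b∉H H-unique)
          H⁺⊆ : x ∷ b ∷ H ⊆ S
          H⁺⊆ (here refl)         = x∈S
          H⁺⊆ (there (here refl)) = b∈S
          H⁺⊆ (there (there p))   = proj₁ (∈-∖⁻ S (proj₁ (∈-∖⁻ T (H⊆ p))))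
        ... | I , I-unique , I⊆ , I-stable , le = conclude (a ∈? I) (b ∈? I)
          where
          bound : ∀ {j w} → I ⊆ w ∷ j → length H ≤ k + (length j + length j)
          bound {j} sub = subst (_≤ k + (length j + length j)) (+-identityʳ (length H))
            -- Two vertices were added and at most one is given up, so `p` is 1.
            (cancel-twice (length H) 0 1 k
              (subst (_≤ k + (length I + length I)) (+-comm 2 (length H)) le)
              (subst (length I ≤_) (+-comm 1 (length j)) (length-mono-⊆ I-unique sub)))

          drop : ∀ {w} L → (∀ {v} → v ∈ I → v ∈ L → v ≡ w) → I ⊆ w ∷ (I ∖ L)
          drop L only {v} v∈I with v ∈? L
          ... | yes v∈L = here (only v∈I v∈L)
          ... | no  v∉L = there (∈-∖⁺ v∈I v∉L)

          Result : Set
          Result = ∃ λ I′ → Unique I′ × I′ ⊆ H × Stable quotient I′ × length H ≤ k + (length I′ + length I′)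

          without-xab : ∀ {w} → (∀ {v} → v ∈ I → v ∈ x ∷ a ∷ b ∷ [] → v ≡ w) → Result
          without-xab only = I ∖ (x ∷ a ∷ b ∷ []) , ∖-unique I-unique , sub ,
            quotient-stable I-stable (λ _ p → lift p) , bound (drop _ only)
            where
            sub : I ∖ (x ∷ a ∷ b ∷ []) ⊆ H
            sub p with ∈-∖⁻ I p
            ... | v∈I , v∉ with I⊆ v∈I
            ...   | here refl         = ⊥-elim (v∉ (here refl))
            ...   | there (here refl) = ⊥-elim (v∉ (there (there (here refl))))
            ...   | there (there q)   = q
            lift : ∀ {u} → rename u ∈ I ∖ (x ∷ a ∷ b ∷ []) → u ∈ I
            lift p with ∈-∖⁻ I p
            ... | q , ∉ = subst (_∈ I) (rename-≢a (λ eq → ∉ (there (here eq)))) q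

          conclude : Dec (a ∈ I) → Dec (b ∈ I) → Result
          conclude (yes a∈I) (yes b∈I) = I ∖ (b ∷ []) , ∖-unique I-unique , sub ,
            quotient-stable I-stable (λ _ → lift) , bound (drop (b ∷ []) λ where _ (here eq) → eq)
            where
            sub : I ∖ (b ∷ []) ⊆ H
            sub p with ∈-∖⁻ I p
            ... | v∈I , v∉ with I⊆ v∈I
            ...   | here refl         = ⊥-elim (I-stable v∈I a∈I x~a)
            ...   | there (here refl) = ⊥-elim (v∉ (here refl))
            ...   | there (there q)   = q
            lift : ∀ {u} → rename u ∈ I ∖ (b ∷ []) → u ∈ I
            lift {u} p with u ≟ b
            ... | yes refl = b∈I
            ... | no  u≢b  = proj₁ (∈-∖⁻ I p)
          conclude (yes a∈I) (no b∉I) = without-xab {a} λ where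
            v∈I (here refl)                 → ⊥-elim (I-stable v∈I a∈I x~a)
            _   (there (here eq))           → eq
            v∈I (there (there (here refl))) → ⊥-elim (b∉I v∈I)
          conclude (no a∉I) (yes b∈I) = without-xab {b} λ where
            v∈I (here refl)               → ⊥-elim (I-stable v∈I b∈I x~b)
            v∈I (there (here refl))       → ⊥-elim (a∉I v∈I)
            _   (there (there (here eq))) → eq
          conclude (no a∉I) (no b∉I) = without-xab {x} λ where
            _   (here eq)                   → eq
            v∈I (there (here refl))         → ⊥-elim (a∉I v∈I)
            v∈I (there (there (here refl))) → ⊥-elim (b∉I v∈I)

      -- The colouring obtained leaves `x` out; `c a ≡ c b` makes two neighbours of `x` share a
      -- colour, which later frees one for `x`.
      identify-neighbours : ∃₂ λ G′ S′ → Unique S′ × length S′ < length S × Good G′ k S′ ×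
        (∀ {m} → Colourable G′ m S′ →
          ∃ λ (c : V → Fin m) → (∀ {u v} → u ∈ T → v ∈ T → u ~ v → c u ≢ c v) × c a ≡ c b)
      identify-neighbours = quotient , S′ , ∖-unique (∖-unique S-unique) , shorter , good′ , colour
        where
        shorter : length S′ < length S
        shorter = begin-strict
          length S′           ≤⟨ length-filter _ T ⟩
          length T            <⟨ n<1+n _ ⟩
          1 + length T        ≡⟨ +-comm 1 (length T) ⟩
          length T + 1        ≤⟨ length-∖-⊆ S-unique ([] ∷ []) (λ where (here refl) → x∈S) ⟩
          length S            ∎
          where open ≤-Reasoning
        rename-∈ : ∀ {v} → v ∈ T → rename v ∈ S′
        rename-∈ {v} v∈T with v ≟ b
        ... | yes _ = ∈-∖⁺ (∈-∖⁺ a∈S λ where (here refl) → ~-irr x~a) λ where (here eq) → a≢b eq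
        ... | no  p = ∈-∖⁺ v∈T λ where (here eq) → p eq
        colour : ∀ {m} → Colourable quotient m S′ →
          ∃ λ (c : V → Fin m) → (∀ {u v} → u ∈ T → v ∈ T → u ~ v → c u ≢ c v) × c a ≡ c b
        colour (c , proper) = c ∘ rename ,
          (λ u∈ v∈ u~v → proper (rename-∈ u∈) (rename-∈ v∈) (~/-intro u∈ v∈ u~v)) ,
          cong c (trans (rename-≢ a≢b) (sym rename-b))

  -- Edge counts and cycles in bipartite graphs.

  module _ (G : DecGraph V) where
    open DecGraph G

    edges : List V → List V → List (V × V)
    edges A B = filter (λ (a , b) → a ~? b) (cartesianProduct A B)

    ∈-edges⁺ : ∀ {A B a b} → a ∈ A → b ∈ B → a ~ b → (a , b) ∈ edges A B
    ∈-edges⁺ a∈ b∈ a~b = ∈-filter⁺ _ (∈-cartesianProduct⁺ a∈ b∈) a~b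

    ∈-edges⁻ : ∀ A B {a b} → (a , b) ∈ edges A B → a ∈ A × b ∈ B × a ~ b
    ∈-edges⁻ A B p with ∈-filter⁻ (λ (a , b) → a ~? b) {xs = cartesianProduct A B} p
    ... | q , a~b = let a∈ , b∈ = ∈-cartesianProduct⁻ A B q in a∈ , b∈ , a~b

    edges-unique : ∀ {A B} → Unique A → Unique B → Unique (edges A B)
    edges-unique u v = Unique.filter⁺ _ (Unique.cartesianProduct⁺ u v)

    neighbours : V → List V → List V
    neighbours v = filter (v ~?_)

    ∈-neighbours⁻ : ∀ {u v} L → u ∈ neighbours v L → u ∈ L × v ~ u
    ∈-neighbours⁻ {v = v} L = ∈-filter⁻ (v ~?_) {xs = L}

    edges-∖ˡ : ∀ {A B} a → Unique A → Unique B →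
               length (edges A B) ≤ length (edges (A ∖ [ a ]) B) + length (neighbours a B)
    edges-∖ˡ {A} {B} a u v = begin
      length (edges A B)                                                  ≤⟨ length-mono-⊆ (edges-unique u v) sub ⟩
      length (edges (A ∖ [ a ]) B ++ map (a ,_) (neighbours a B))         ≡⟨ length-++ (edges (A ∖ [ a ]) B) ⟩
      length (edges (A ∖ [ a ]) B) + length (map (a ,_) (neighbours a B)) ≡⟨ cong (length (edges (A ∖ [ a ]) B) +_) (length-map _ (neighbours a B)) ⟩
      length (edges (A ∖ [ a ]) B) + length (neighbours a B)              ∎
      where
      open ≤-Reasoning
      sub : edges A B ⊆ edges (A ∖ [ a ]) B ++ map (a ,_) (neighbours a B)
      sub {a′ , b} p with ∈-edges⁻ A B p | a′ ≟ a
      ... | _  , b∈ , a~b | yes refl = ∈-++⁺ʳ (edges (A ∖ [ a ]) B) (∈-map⁺ _ (∈-filter⁺ _ b∈ a~b))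
      ... | a∈ , b∈ , a~b | no  a′≢a = ∈-++⁺ˡ (∈-edges⁺ (∈-∖⁺ a∈ λ where (here eq) → a′≢a eq) b∈ a~b)

    edges-∖ʳ : ∀ {A B} b → Unique A → Unique B →
               length (edges A B) ≤ length (edges A (B ∖ [ b ])) + length (neighbours b A)
    edges-∖ʳ {A} {B} b u v = begin
      length (edges A B)                                                  ≤⟨ length-mono-⊆ (edges-unique u v) sub ⟩
      length (edges A (B ∖ [ b ]) ++ map (_, b) (neighbours b A))         ≡⟨ length-++ (edges A (B ∖ [ b ])) ⟩
      length (edges A (B ∖ [ b ])) + length (map (_, b) (neighbours b A)) ≡⟨ cong (length (edges A (B ∖ [ b ])) +_) (length-map _ (neighbours b A)) ⟩
      length (edges A (B ∖ [ b ])) + length (neighbours b A)              ∎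
      where
      open ≤-Reasoning
      sub : edges A B ⊆ edges A (B ∖ [ b ]) ++ map (_, b) (neighbours b A)
      sub {a , b′} p with ∈-edges⁻ A B p | b′ ≟ b
      ... | a∈ , _  , a~b | yes refl = ∈-++⁺ʳ (edges A (B ∖ [ b ])) (∈-map⁺ _ (∈-filter⁺ _ a∈ (~-sym a~b)))
      ... | a∈ , b∈ , a~b | no  b′≢b = ∈-++⁺ˡ (∈-edges⁺ a∈ (∈-∖⁺ b∈ λ where (here eq) → b′≢b eq) a~b)

    -- Cuts a trail at `a` and leaves towards `w` instead; with `w` the current end of a walk, this
    -- closes a cycle.
    truncate : ∀ {x z ps a w} → Trail G x z ps → a ∈ map proj₂ ps → a ~ w →
               ∃₂ λ ps′ qs → ps ≡ ps′ ++ qs × 1 ≤ length ps′ × Trail G x w ps′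
    truncate (step x~y _ t) (here refl) a~w = _ ∷ [] , _ , refl , s≤s z≤n , step x~y a~w done
    truncate (step x~y y~x′ t) (there p) a~w with truncate t p a~w
    ... | ps′ , qs , refl , _ , t′ = _ ∷ ps′ , qs , refl , s≤s z≤n , step x~y y~x′ t′

    -- Prepending a to a trail regroups its vertices: the pairs (x₀,y₀),(x₁,y₁),… become (a,x₀),(y₀,x₁),….
    regroup : ∀ {x z ps a b w} → Trail G x z ps → a ~ x → b ∈ map proj₁ ps ++ [ z ] → b ~ w →
              ∃ λ qs → 1 ≤ length qs × Trail G a w qs ×
                (∃ λ r → a ∷ map proj₂ ps ≡ map proj₁ qs ++ r) ×
                (∃ λ r → map proj₁ ps ++ [ z ] ≡ map proj₂ qs ++ r)
    regroup done a~x (here refl) b~w =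
      _ ∷ [] , s≤s z≤n , step a~x b~w done , (_ , refl) , (_ , refl)
    regroup (step _ _ _) a~x (here refl) b~w =
      _ ∷ [] , s≤s z≤n , step a~x b~w done , (_ , refl) , (_ , refl)
    regroup (step x~y y~x′ t) a~x (there p) b~w with regroup t y~x′ p b~w
    ... | qs , _ , t′ , (r , eq) , (r′ , eq′) =
      _ ∷ qs , s≤s z≤n , step a~x x~y t′ , (r , cong (_ ∷_) eq) , (r′ , cong (_ ∷_) eq′)

    two-elements : ∀ {L : List V} (w : V) → Unique L → 2 ≤ length L → ∃ λ v → v ∈ L × v ≢ w
    two-elements {p ∷ q ∷ L} w u _ with p ≟ w
    ... | no  p≢w  = p , here refl , p≢w
    ... | yes refl = q , there (here refl) , λ eq → Unique[x∷xs]⇒x∉xs u (here (sym eq))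
    two-elements {_ ∷ []} w u (s≤s ())

    module _ {S A B : List V} (A-unique : Unique A) (B-unique : Unique B) (A⊆S : A ⊆ S) (B⊆S : B ⊆ S)
             (A-stable : Stable G A) (B-stable : Stable G B) (A∩B : ∀ {v} → v ∈ A → v ∉ B)
             (A-degree : ∀ {a} → a ∈ A → 2 ≤ length (neighbours a B))
             (B-degree : ∀ {b} → b ∈ B → 2 ≤ length (neighbours b A)) where

      private
        -- The vertex of `A` from which the walk reached `x`, avoided so as not to turn back. On an
        -- empty trail the default `x` excludes no neighbour, since `x` is not adjacent to itself.
        previous : V → List (V × V) → V
        previous x []            = x
        previous _ ((_ , y) ∷ _) = y

      -- A path is grown at its front `x`, first to some `a` and then to some `b`; minimum degree
      -- two always permits a step that does not turn back. A repeated vertex closes a cycle. The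
      -- path holds `length ps + 1` distinct vertices of `B`, so `n` cannot run out.
      walk : ∀ n {x z ps} → length B ≤ length ps + n → Trail G x z ps → x ∈ B →
             map proj₁ ps ++ [ z ] ⊆ B → map proj₂ ps ⊆ A →
             Unique (map proj₁ ps ++ [ z ]) → Unique (map proj₂ ps) → StableCycle G S
      walk zero {x} {z} {ps} B≤ t x∈B ⊆B ⊆A uB uA = ⊥-elim (1+n≰n (begin
        suc (length ps)                  ≡⟨ +-comm 1 (length ps) ⟩
        length ps + 1                    ≡⟨ cong (_+ 1) (length-map proj₁ ps) ⟨
        length (map proj₁ ps) + 1        ≡⟨ length-++ (map proj₁ ps) ⟨
        length (map proj₁ ps ++ [ z ])   ≤⟨ length-mono-⊆ uB ⊆B ⟩
        length B                         ≤⟨ B≤ ⟩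
        length ps + 0                    ≡⟨ +-identityʳ (length ps) ⟩
        length ps                        ∎))
        where open ≤-Reasoning
      walk (suc n) {x} {z} {ps} B≤ t x∈B ⊆B ⊆A uB uA
        with two-elements (previous x ps) (Unique.filter⁺ _ A-unique) (B-degree x∈B)
      ... | a , a∈N , a≢ with ∈-neighbours⁻ A a∈N | a ∈? map proj₂ ps
      walk (suc n) B≤ (step x~y _ t) x∈B ⊆B ⊆A uB uA | a , a∈N , a≢ | a∈A , x~a | yes (here refl) = ⊥-elim (a≢ refl)
      -- The repeated `a` is not the previous vertex `y`, so it lies in the tail and the cycle has a
      -- second pair.
      walk (suc n) B≤ (step {x} {y} {z = z} x~y y~x′ t) x∈B ⊆B ⊆A uB uA | a , a∈N , a≢ | a∈A , x~a | yes (there p)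
        with truncate t p (~-sym x~a)
      ... | qs , r , refl , longer , t′ = record
        { x₀ = x ; y₀ = y ; rest = qs ; longer = longer ; trail = step x~y y~x′ t′
        ; X-unique = Unique-++⁻ˡ (x ∷ map proj₁ qs) (subst Unique eq₁ uB)
        ; Y-unique = Unique-++⁻ˡ (y ∷ map proj₂ qs) (subst Unique eq₂ uA)
        ; X⊆S = B⊆S ∘ X⊆B ; Y⊆S = A⊆S ∘ Y⊆A
        ; disjoint = λ p q → A∩B (Y⊆A q) (X⊆B p)
        ; X-stable = Stable-⊆ G X⊆B B-stable ; Y-stable = Stable-⊆ G Y⊆A A-stable
        }
        where
        eq₁ : x ∷ map proj₁ (qs ++ r) ++ [ z ] ≡ (x ∷ map proj₁ qs) ++ (map proj₁ r ++ [ z ])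
        eq₁ = cong (x ∷_) (trans (cong (_++ [ z ]) (map-++ proj₁ qs r)) (++-assoc (map proj₁ qs) _ _))
        eq₂ : y ∷ map proj₂ (qs ++ r) ≡ (y ∷ map proj₂ qs) ++ map proj₂ r
        eq₂ = cong (y ∷_) (map-++ proj₂ qs r)
        X⊆B : x ∷ map proj₁ qs ⊆ B
        X⊆B {v} p = ⊆B (subst (v ∈_) (sym eq₁) (∈-++⁺ˡ p))
        Y⊆A : y ∷ map proj₂ qs ⊆ A
        Y⊆A {v} p = ⊆A (subst (v ∈_) (sym eq₂) (∈-++⁺ˡ p))
      walk (suc n) {x} {z} {ps} B≤ t x∈B ⊆B ⊆A uB uA | a , a∈N , a≢ | a∈A , x~a | no a∉
        with two-elements x (Unique.filter⁺ _ B-unique) (A-degree a∈A)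
      ... | b , b∈N , b≢x with ∈-neighbours⁻ B b∈N | b ∈? (map proj₁ ps ++ [ z ])
      ... | b∈B , a~b | no b∉ =
        walk n (≤-trans B≤ (≤-reflexive (+-suc _ n))) (step (~-sym a~b) (~-sym x~a) t) b∈B
          (λ where (here refl) → b∈B ; (there p) → ⊆B p)
          (λ where (here refl) → a∈A ; (there p) → ⊆A p)
          (Unique-∷ b∉ uB) (Unique-∷ a∉ uA)
      walk (suc n) B≤ done x∈B ⊆B ⊆A uB uA | a , a∈N , a≢ | a∈A , x~a | no a∉ | b , b∈N , b≢x | b∈B , a~b | yes (here refl) =
        ⊥-elim (b≢x refl)
      walk (suc n) B≤ (step _ _ _) x∈B ⊆B ⊆A uB uA | a , a∈N , a≢ | a∈A , x~a | no a∉ | b , b∈N , b≢x | b∈B , a~b | yes (here refl) =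
        ⊥-elim (b≢x refl)
      -- The cycle closes through the new vertex `a` and is read from there, so the sides trade
      -- places: `X` lies in `A` and `Y` in `B`.
      walk (suc n) B≤ (step {x} x~y y~x′ t) x∈B ⊆B ⊆A uB uA | a , a∈N , a≢ | a∈A , x~a | no a∉ | b , b∈N , b≢x | b∈B , a~b | yes (there p)
        with regroup t y~x′ p (~-sym a~b)
      ... | qs , longer , t′ , (r , eq) , (r′ , eq′) = record
        { x₀ = a ; y₀ = x ; rest = qs ; longer = longer ; trail = step (~-sym x~a) x~y t′
        ; X-unique = Unique-++⁻ˡ (a ∷ map proj₁ qs) (subst (λ l → Unique (a ∷ l)) eq (Unique-∷ a∉ uA))
        ; Y-unique = Unique-++⁻ˡ (x ∷ map proj₂ qs) (subst (λ l → Unique (x ∷ l)) eq′ uB)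
        ; X⊆S = A⊆S ∘ X⊆A ; Y⊆S = B⊆S ∘ Y⊆B
        ; disjoint = λ p q → A∩B (X⊆A p) (Y⊆B q)
        ; X-stable = Stable-⊆ G X⊆A A-stable ; Y-stable = Stable-⊆ G Y⊆B B-stable
        }
        where
        X⊆A : a ∷ map proj₁ qs ⊆ A
        X⊆A (here refl) = a∈A
        X⊆A (there p)   = ⊆A (subst (_ ∈_) (sym eq) (∈-++⁺ˡ p))
        Y⊆B : x ∷ map proj₂ qs ⊆ B
        Y⊆B (here refl) = x∈B
        Y⊆B (there p)   = ⊆B (there (subst (_ ∈_) (sym eq′) (∈-++⁺ˡ p)))

    -- Removing a vertex of degree at most one loses at most one edge, so the bound passes from the
    -- smaller graph. Without such a vertex, `walk` finds a cycle. `n` only drives the recursion.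
    forest-or-cycle : ∀ n {S A B} → length A + length B ≤ n → 1 ≤ length A + length B →
      Unique A → Unique B → A ⊆ S → B ⊆ S → Stable G A → Stable G B → (∀ {v} → v ∈ A → v ∉ B) →
      StableCycle G S ⊎ length (edges A B) < length A + length B
    forest-or-cycle n {A = []} _ le _ _ _ _ _ _ _ = inj₂ le
    forest-or-cycle n {A = A@(_ ∷ _)} {[]} _ le uA uB _ _ _ _ _ =
      inj₂ (≤-trans (s≤s (length-mono-⊆ {ys = []} (edges-unique {A} uA uB) λ p → ⊥-elim (¬Any[] (proj₁ (proj₂ (∈-edges⁻ A [] p)))))) le)
    forest-or-cycle (suc n) {S} {A@(_ ∷ _)} {B@(b₀ ∷ _)} (s≤s le) _ uA uB A⊆S B⊆S sA sB A∩B
      with any? (λ a → length (neighbours a B) ≤? 1) A | any? (λ b → length (neighbours b A) ≤? 1) B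
    ... | yes p | _ = remove (find p)
      where
      remove : (∃ λ a → a ∈ A × length (neighbours a B) ≤ 1) → _
      remove (a , a∈A , deg) = Sum.map₂ (λ ih → begin
          suc (length (edges A B))                            ≤⟨ s≤s (≤-trans (edges-∖ˡ {A} {B} a uA uB) (+-monoʳ-≤ _ deg)) ⟩
          suc (length (edges A′ B)) + 1                       ≤⟨ +-monoˡ-≤ 1 ih ⟩
          length A′ + length B + 1                            ≡⟨ +-assoc (length A′) (length B) 1 ⟩
          length A′ + (length B + 1)                          ≡⟨ cong (length A′ +_) (+-comm (length B) 1) ⟩
          length A′ + (1 + length B)                          ≡⟨ +-assoc (length A′) 1 (length B) ⟨
          length A′ + 1 + length B                            ≤⟨ +-monoˡ-≤ (length B) smaller ⟩
          length A + length B                                 ∎)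
        (forest-or-cycle n {S} {A′} {B} (≤-trans (+-monoˡ-≤ (length B) smaller′) le) (≤-trans (s≤s z≤n) (m≤n+m (length B) (length A′)))
          (∖-unique {A} {[ a ]} uA) uB (A⊆S ∘ A′⊆A) B⊆S (Stable-⊆ G A′⊆A sA) sB (A∩B ∘ A′⊆A))
        where
        open ≤-Reasoning
        A′ = A ∖ [ a ]
        A′⊆A : A′ ⊆ A
        A′⊆A p = proj₁ (∈-∖⁻ A {[ a ]} p)
        smaller : length A′ + 1 ≤ length A
        smaller = length-∖-⊆ {A} {[ a ]} uA ([] ∷ []) (λ where (here refl) → a∈A)
        smaller′ : length A′ ≤ _
        smaller′ = s≤s⁻¹ (subst (_≤ length A) (+-comm (length A′) 1) smaller)
    ... | no _ | yes p = remove (find p)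
      where
      remove : (∃ λ b → b ∈ B × length (neighbours b A) ≤ 1) → _
      remove (b , b∈B , deg) = Sum.map₂ (λ ih → begin
          suc (length (edges A B))                            ≤⟨ s≤s (≤-trans (edges-∖ʳ {A} {B} b uA uB) (+-monoʳ-≤ _ deg)) ⟩
          suc (length (edges A B′)) + 1                       ≤⟨ +-monoˡ-≤ 1 ih ⟩
          length A + length B′ + 1                            ≡⟨ +-assoc (length A) (length B′) 1 ⟩
          length A + (length B′ + 1)                          ≤⟨ +-monoʳ-≤ (length A) smaller ⟩
          length A + length B                                 ∎)
        (forest-or-cycle n {S} {A} {B′} (s≤s⁻¹ (≤-trans (≤-reflexive (trans (sym (+-suc (length A) (length B′))) (cong (length A +_) (+-comm 1 (length B′)))))
                                     (≤-trans (+-monoʳ-≤ (length A) smaller) (s≤s le))))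
          (s≤s z≤n) uA (∖-unique {B} {[ b ]} uB) A⊆S (B⊆S ∘ B′⊆B) sA (Stable-⊆ G B′⊆B sB) (λ p q → A∩B p (B′⊆B q)))
        where
        open ≤-Reasoning
        B′ = B ∖ [ b ]
        B′⊆B : B′ ⊆ B
        B′⊆B p = proj₁ (∈-∖⁻ B {[ b ]} p)
        smaller : length B′ + 1 ≤ length B
        smaller = length-∖-⊆ {B} {[ b ]} uB ([] ∷ []) (λ where (here refl) → b∈B)
    ... | no p | no q =
      inj₁ (walk {S = S} uA uB A⊆S B⊆S sA sB A∩B (λ a∈ → ≰⇒> (λ le → p (lose a∈ le))) (λ b∈ → ≰⇒> (λ le → q (lose b∈ le)))
        (length B) {b₀} {b₀} {[]} ≤-refl done (here refl) (λ where (here refl) → here refl) (λ ()) ([] ∷ []) [])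

    edges-split : ∀ {A B B₁ B₂} → Unique A → Unique B → (∀ {b} → b ∈ B → b ∈ B₁ ⊎ b ∈ B₂) →
                  length (edges A B) ≤ length (edges A B₁) + length (edges A B₂)
    edges-split {A} {B} {B₁} {B₂} u v split =
      ≤-trans (length-mono-⊆ (edges-unique u v) sub) (≤-reflexive (length-++ (edges A B₁)))
      where
      sub : edges A B ⊆ edges A B₁ ++ edges A B₂
      sub p with ∈-edges⁻ A B p
      ... | a∈ , b∈ , a~b with split b∈
      ...   | inj₁ q = ∈-++⁺ˡ (∈-edges⁺ a∈ q a~b)
      ...   | inj₂ q = ∈-++⁺ʳ (edges A B₁) (∈-edges⁺ a∈ q a~b)

    -- The forest bound is summed over the colour classes of `B`, each saving one edge; `A` being
    -- non-empty, even an empty class saves one. Colours are natural numbers so that peeling off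
    -- class `m` leaves colours below `m`.
    edges-coloured : ∀ m {S A B} (c : V → ℕ) → 1 ≤ length A → (∀ {b} → b ∈ B → c b < m) →
      (∀ {u v} → u ∈ B → v ∈ B → u ~ v → c u ≢ c v) →
      Unique A → Unique B → A ⊆ S → B ⊆ S → Stable G A → (∀ {v} → v ∈ A → v ∉ B) →
      StableCycle G S ⊎ length (edges A B) + m ≤ m * length A + length B
    edges-coloured zero {A = A} {B} c _ c< _ uA uB _ _ _ _ = inj₂ (subst (_≤ length B) (sym (+-identityʳ _))
      (≤-trans (length-mono-⊆ {ys = []} (edges-unique uA uB) λ p → ⊥-elim (n≮0 (c< (proj₁ (proj₂ (∈-edges⁻ A B p)))))) z≤n))
    edges-coloured (suc m) {S} {A} {B} c 1≤A c< proper uA uB A⊆S B⊆S sA A∩B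
      with forest-or-cycle (length A + length B₁) {S} {A} {B₁} ≤-refl (≤-trans 1≤A (m≤m+n _ _)) uA (Unique.filter⁺ c≡? uB) A⊆S
             (λ p → B⊆S (proj₁ (∈-filter⁻ c≡? {xs = B} p))) sA
             (λ p q u~v → let u∈ , cu = ∈-filter⁻ c≡? {xs = B} p ; v∈ , cv = ∈-filter⁻ c≡? {xs = B} q in
                proper u∈ v∈ u~v (trans cu (sym cv)))
             (λ p q → A∩B p (proj₁ (∈-filter⁻ c≡? {xs = B} q)))
         | edges-coloured m {S} {A} {B₂} c 1≤A
             (λ p → let b∈ , c≢ = ∈-filter⁻ c≢? {xs = B} p in ≤∧≢⇒< (s≤s⁻¹ (c< b∈)) c≢)
             (λ p q → proper (proj₁ (∈-filter⁻ c≢? {xs = B} p)) (proj₁ (∈-filter⁻ c≢? {xs = B} q)))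
             uA (Unique.filter⁺ c≢? uB) A⊆S
             (λ p → B⊆S (proj₁ (∈-filter⁻ c≢? {xs = B} p))) sA
             (λ p q → A∩B p (proj₁ (∈-filter⁻ c≢? {xs = B} q)))
      where
      c≡? = λ v → c v ≟ℕ m
      c≢? = λ v → ¬? (c v ≟ℕ m)
      B₁ = filter c≡? B
      B₂ = filter c≢? B
    ... | inj₁ C | _      = inj₁ C
    ... | inj₂ _ | inj₁ C = inj₁ C
    ... | inj₂ e₁ | inj₂ e₂ = inj₂ (begin
      length (edges A B) + suc m                                        ≤⟨ +-monoˡ-≤ (suc m) (edges-split {A} {B} {B₁} {B₂} uA uB split) ⟩
      length (edges A B₁) + length (edges A B₂) + suc m                 ≡⟨ shuffle₁ (length (edges A B₁)) (length (edges A B₂)) m ⟩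
      suc (length (edges A B₁)) + (length (edges A B₂) + m)             ≤⟨ +-mono-≤ e₁ e₂ ⟩
      length A + length B₁ + (m * length A + length B₂)                 ≡⟨ shuffle₂ (length A) (length B₁) (m * length A) (length B₂) ⟩
      length A + m * length A + (length B₁ + length B₂)                 ≤⟨ +-monoʳ-≤ (length A + m * length A) classes ⟩
      length A + m * length A + length B                                ∎)
      where
      open ≤-Reasoning
      c≡? = λ v → c v ≟ℕ m
      c≢? = λ v → ¬? (c v ≟ℕ m)
      B₁ = filter c≡? B
      B₂ = filter c≢? B
      split : ∀ {b} → b ∈ B → b ∈ B₁ ⊎ b ∈ B₂
      split {b} b∈ with c b ≟ℕ m
      ... | yes p = inj₁ (∈-filter⁺ c≡? b∈ p)
      ... | no  p = inj₂ (∈-filter⁺ c≢? b∈ p)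
      classes : length B₁ + length B₂ ≤ length B
      classes = ≤-trans (≤-reflexive (sym (length-++ B₁)))
        (length-mono-⊆ (Unique.++⁺ (Unique.filter⁺ c≡? uB) (Unique.filter⁺ c≢? uB)
            (λ (p , q) → proj₂ (∈-filter⁻ c≢? {xs = B} q) (proj₂ (∈-filter⁻ c≡? {xs = B} p))))
          (λ p → Sum.[ (λ q → proj₁ (∈-filter⁻ c≡? {xs = B} q)) , (λ q → proj₁ (∈-filter⁻ c≢? {xs = B} q)) ]′ (∈-++⁻ B₁ p)))
      shuffle₁ : ∀ a b m → a + b + suc m ≡ suc a + (b + m)
      shuffle₁ = solve-∀
      shuffle₂ : ∀ a b c d → a + b + (c + d) ≡ a + c + (b + d)
      shuffle₂ = solve-∀

    -- Averaging: the degrees of the vertices of `A` add up to the number of edges.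
    low-degree : ∀ d {A B} → Unique A → Unique B →
      (∃ λ x → x ∈ A × length (neighbours x B) ≤ d) ⊎ suc d * length A ≤ length (edges A B)
    low-degree d {[]} _ _ = inj₂ (≤-reflexive (*-zeroʳ (suc d)))
    low-degree d {x ∷ A} {B} u@(_ ∷ uA) uB with length (neighbours x B) ≤? d | low-degree d {A} {B} uA uB
    ... | yes p | _                    = inj₁ (x , here refl , p)
    ... | no  _ | inj₁ (y , y∈A , q) = inj₁ (y , there y∈A , q)
    ... | no  p | inj₂ q              = inj₂ (begin
      suc d * suc (length A)                                            ≡⟨ *-suc (suc d) (length A) ⟩
      suc d + suc d * length A                                          ≤⟨ +-mono-≤ (≰⇒> p) q ⟩
      length (neighbours x B) + length (edges A B)                      ≡⟨ cong (_+ length (edges A B)) (length-map (x ,_) (neighbours x B)) ⟨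
      length (map (x ,_) (neighbours x B)) + length (edges A B)         ≡⟨ length-++ (map (x ,_) (neighbours x B)) ⟨
      length (map (x ,_) (neighbours x B) ++ edges A B)                 ≤⟨ length-mono-⊆ unique sub ⟩
      length (edges (x ∷ A) B)                                          ∎)
      where
      open ≤-Reasoning
      unique : Unique (map (x ,_) (neighbours x B) ++ edges A B)
      unique = Unique.++⁺ (Unique.map⁺ (cong proj₂) (Unique.filter⁺ _ uB)) (edges-unique {A} {B} uA uB) disj
        where
        disj : ∀ {e} → ¬ (e ∈ map (x ,_) (neighbours x B) × e ∈ edges A B)
        disj (r , s) with ∈-map⁻ (x ,_) r
        ... | _ , _ , refl = Unique[x∷xs]⇒x∉xs u (proj₁ (∈-edges⁻ A B s))
      sub : map (x ,_) (neighbours x B) ++ edges A B ⊆ edges (x ∷ A) B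
      sub r with ∈-++⁻ (map (x ,_) (neighbours x B)) r
      ... | inj₁ s with ∈-map⁻ (x ,_) s
      ...   | _ , t , refl = let b∈ , x~b = ∈-neighbours⁻ B t in ∈-edges⁺ {x ∷ A} (here refl) b∈ x~b
      sub r | inj₂ s = let a∈ , b∈ , a~b = ∈-edges⁻ A B s in ∈-edges⁺ (there a∈) b∈ a~b

    -- Colouring one more vertex, and the size of cliques.

    extend-colouring : ∀ {m S x} (c : V → Fin m) →
      (∀ {u v} → u ∈ S ∖ [ x ] → v ∈ S ∖ [ x ] → u ~ v → c u ≢ c v) →
      (L : List (Fin m)) → length L < m → (∀ {v} → v ∈ S → x ~ v → c v ∈ L) → Colourable G m S
    extend-colouring {m} {S} {x} c proper L L<m seen = c′ , proper′
      where
      free = proj₁ (fresh L L<m)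
      free∉ : free ∉ L
      free∉ = proj₂ (fresh L L<m)
      c′ : V → Fin m
      c′ v with v ≟ x
      ... | yes _ = free
      ... | no  _ = c v
      proper′ : ∀ {u v} → u ∈ S → v ∈ S → u ~ v → c′ u ≢ c′ v
      proper′ {u} {v} u∈ v∈ u~v with u ≟ x | v ≟ x
      ... | yes refl | yes refl = λ _ → ~-irr u~v
      ... | yes refl | no  _    = λ eq → free∉ (subst (_∈ L) (sym eq) (seen v∈ u~v))
      ... | no  _    | yes refl = λ eq → free∉ (subst (_∈ L) eq (seen u∈ (~-sym u~v)))
      ... | no  p    | no  q    = proper (∈-∖⁺ u∈ λ where (here eq) → p eq) (∈-∖⁺ v∈ λ where (here eq) → q eq) u~v

    -- A stable set meets a clique in at most one vertex, so 2α is at most 2.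
    clique-small : ∀ {k S L} → Good G k S → L ⊆ S → Unique L → (∀ {u v} → u ∈ L → v ∈ L → u ≢ v → u ~ v) →
                   length L ≤ k + 2
    clique-small {k} good L⊆S uL adjacent with good _ uL L⊆S
    ... | I , uI , I⊆L , sI , le = ≤-trans le (+-monoʳ-≤ k (+-mono-≤ (small uI I⊆L sI) (small uI I⊆L sI)))
      where
      small : ∀ {I} → Unique I → I ⊆ _ → Stable G I → length I ≤ 1
      small {[]}        _ _   _  = z≤n
      small {_ ∷ []}    _ _   _  = s≤s z≤n
      small {a ∷ b ∷ _} u sub st = ⊥-elim (st (here refl) (there (here refl))
        (adjacent (sub (here refl)) (sub (there (here refl))) (λ eq → Unique[x∷xs]⇒x∉xs u (here eq))))

  -- Induction on the number of vertices.

  module _ (k : ℕ) where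

    private
      -- The graph is quantified inside because the induction passes to quotients, which change
      -- adjacency.
      Goal : ℕ → Set₁
      Goal n = ∀ (G : DecGraph V) {S} → length S ≤ n → Unique S → Good G k S → Colourable G (k + 2) S

      -- With at most `k + 1` neighbours, `x` can be coloured last. With exactly `k + 2`, two of
      -- them are non-adjacent and are given the same colour.
      extend-at : ∀ {n} → Goal n → (G : DecGraph V) → ∀ {S x} → length S ≤ suc n → Unique S → Good G k S →
                  x ∈ S → length (neighbours G x S) ≤ k + 2 → Colourable G (k + 2) S
      extend-at {n} ih G {S} {x} S≤ uS good x∈S deg with length (neighbours G x S) ≤? k + 1
      ... | yes deg′ =
        let c , proper = ih G (s≤s⁻¹ (≤-trans (≤-trans (≤-reflexive (+-comm 1 _)) (length-∖-⊆ uS ([] ∷ []) (λ where (here refl) → x∈S))) S≤))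
                           (∖-unique uS) (Good-⊆ G {k} {S} (λ p → proj₁ (∈-∖⁻ S {[ x ]} p)) good)
        in extend-colouring G c proper (map c (neighbours G x S))
             (≤-trans (s≤s (≤-trans (≤-reflexive (length-map c (neighbours G x S))) deg′)) (≤-reflexive (sym (+-suc k 1))))
             (λ v∈S x~v → ∈-map⁺ c (∈-filter⁺ _ v∈S x~v))
      ... | no big with any? (λ a → any? (λ b → ¬? (a ≟ b) ×-dec ¬? (DecGraph._~?_ G a b)) (neighbours G x S)) (neighbours G x S)
      -- Adding `x` to its pairwise adjacent neighbours gives a clique of more than `k + 2`
      -- vertices.
      ...   | no none = ⊥-elim (big (s≤s⁻¹ (subst (suc (length (neighbours G x S)) ≤_) (+-suc k 1)
                (clique-small G {k} good sub (Unique-∷ x∉ (Unique.filter⁺ _ uS)) adjacent))))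
        where
        open DecGraph G
        N = neighbours G x S
        x∉ : x ∉ N
        x∉ p = ~-irr (proj₂ (∈-neighbours⁻ G S p))
        sub : x ∷ N ⊆ S
        sub (here refl) = x∈S
        sub (there p)   = proj₁ (∈-neighbours⁻ G S p)
        adjacent : ∀ {u v} → u ∈ x ∷ N → v ∈ x ∷ N → u ≢ v → u ~ v
        adjacent (here refl) (here refl) u≢v = ⊥-elim (u≢v refl)
        adjacent (here refl) (there q)   _   = proj₂ (∈-neighbours⁻ G S q)
        adjacent (there p)   (here refl) _   = ~-sym (proj₂ (∈-neighbours⁻ G S p))
        adjacent {u} {v} (there p) (there q) u≢v with u ~? v
        ... | yes u~v = u~v
        ... | no  u≁v = ⊥-elim (none (lose p (lose q (u≢v , u≁v))))
      ...   | yes some with find some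
      ...     | a , a∈ , some′ with find some′
      ...       | b , b∈ , a≢b , a≁b =
        let a∈S , x~a = ∈-neighbours⁻ G S a∈
            b∈S , x~b = ∈-neighbours⁻ G S b∈
            G′ , S′ , uS′ , S′< , good′ , colour = identify-neighbours {k} {G} uS good x∈S a∈S b∈S x~a x~b a≢b a≁b
            c , proper , ca≡cb = colour (ih G′ (s≤s⁻¹ (≤-trans S′< S≤)) uS′ good′)
        -- The colour of `b` is already that of `a`, so the list without `b` still shows every
        -- colour around `x`.
        in extend-colouring G c proper (map c (N ∖ [ b ])) (few c) (seen c ca≡cb)
        where
        N = neighbours G x S
        few : ∀ c → length (map c (N ∖ [ b ])) < k + 2
        few c = begin-strict
          length (map c (N ∖ [ b ]))   ≡⟨ length-map c (N ∖ [ b ]) ⟩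
          length (N ∖ [ b ])           <⟨ n<1+n _ ⟩
          1 + length (N ∖ [ b ])       ≡⟨ +-comm 1 _ ⟩
          length (N ∖ [ b ]) + 1       ≤⟨ length-∖-⊆ (Unique.filter⁺ _ uS) ([] ∷ []) (λ where (here refl) → b∈) ⟩
          length N                     ≤⟨ deg ⟩
          k + 2                        ∎
          where open ≤-Reasoning
        seen : ∀ c → c a ≡ c b → ∀ {v} → v ∈ S → DecGraph._~_ G x v → c v ∈ map c (N ∖ [ b ])
        seen c ca≡cb {v} v∈S x~v with v ≟ b
        ... | yes refl = subst (_∈ map c (N ∖ [ b ])) ca≡cb (∈-map⁺ c (∈-∖⁺ a∈ λ where (here eq) → a≢b eq))
        ... | no  v≢b  = ∈-map⁺ c (∈-∖⁺ (∈-filter⁺ _ v∈S x~v) λ where (here eq) → v≢b eq)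

      -- Here i = |I|, j = |J|, s = |S| and e counts the edges between `I` and `J`. The edge bounds
      -- force i + k + 2 ≤ j, while the last two give j ≤ k + i.
      too-many-edges : ∀ k i j e s → suc (k + 2) * i ≤ e → e + (k + 2) ≤ (k + 2) * i + j → j + i ≤ s → s ≤ k + (i + i) → ⊥
      too-many-edges k i j e s p q r t = 1+n≰n (≤-trans (n≤1+n _) (+-cancelʳ-≤ ((k + 2) * i + i) (2 + k) k (begin
        2 + k + ((k + 2) * i + i)          ≡⟨ shuffle k i ⟩
        suc (k + 2) * i + (k + 2)          ≤⟨ +-monoˡ-≤ (k + 2) p ⟩
        e + (k + 2)                        ≤⟨ q ⟩
        (k + 2) * i + j                    ≤⟨ +-monoʳ-≤ ((k + 2) * i) (+-cancelʳ-≤ i j (k + i) (≤-trans r (≤-trans t (≤-reflexive (sym (+-assoc k i i)))))) ⟩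
        (k + 2) * i + (k + i)              ≡⟨ shuffle′ ((k + 2) * i) k i ⟩
        k + ((k + 2) * i + i)              ∎)))
        where
        open ≤-Reasoning
        shuffle : ∀ k i → 2 + k + ((k + 2) * i + i) ≡ suc (k + 2) * i + (k + 2)
        shuffle = solve-∀
        shuffle′ : ∀ a k i → a + (k + i) ≡ k + (a + i)
        shuffle′ = solve-∀

    good⇒colourable : ∀ n → Goal n
    good⇒colourable n       G {[]}        _  _  _    = (λ _ → fromℕ< (≤-trans (s≤s z≤n) (m≤n+m 2 k))) , λ ()
    good⇒colourable (suc n) G {S@(x ∷ _)} S≤ uS good with good S uS (λ p → p)
    -- An empty stable set means that `S` has at most `k` vertices, so any vertex has low degree.
    ... | [] , _ , _ , _ , le = extend-at (good⇒colourable n) G S≤ uS good (here refl)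
      (≤-trans (length-filter (DecGraph._~?_ G x) S) (≤-trans le (+-monoʳ-≤ k z≤n)))
    ... | I@(_ ∷ _) , uI , I⊆S , sI , le = finish
      where
      open DecGraph G
      J = S ∖ I
      J+I≤S : length J + length I ≤ length S
      J+I≤S = length-∖-⊆ {S} {I} uS uI I⊆S
      J-colour : Colourable G (k + 2) J
      J-colour = good⇒colourable n G
        (s≤s⁻¹ (≤-trans (≤-trans (≤-trans (≤-reflexive (+-comm 1 (length J))) (+-monoʳ-≤ (length J) (s≤s z≤n))) J+I≤S) S≤))
        (∖-unique {S} {I} uS) (Good-⊆ G {k} {S} (λ p → proj₁ (∈-∖⁻ S {I} p)) good)
      c = proj₁ J-colour

      finish : Colourable G (k + 2) S
      finish with edges-coloured G (k + 2) {S} {I} {J} (toℕ ∘ c) (s≤s z≤n) (λ _ → toℕ<n _)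
                    (λ u∈ v∈ u~v eq → proj₂ J-colour u∈ v∈ u~v (toℕ-injective eq))
                    uI (∖-unique {S} {I} uS) I⊆S (λ p → proj₁ (∈-∖⁻ S {I} p)) sI (λ p q → proj₂ (∈-∖⁻ S {I} q) p)
      ... | inj₁ C = let G′ , S′ , uS′ , S′< , good′ , colour = contract-cycle {k} uS good C in
                     colour (good⇒colourable n G′ (s≤s⁻¹ (≤-trans S′< S≤)) uS′ good′)
      ... | inj₂ few with low-degree G (k + 2) {I} {J} uI (∖-unique {S} {I} uS)
      ...   | inj₂ many = ⊥-elim (too-many-edges k _ _ _ _ many few J+I≤S le)
      ...   | inj₁ (y , y∈I , deg) = extend-at (good⇒colourable n) G S≤ uS good (I⊆S y∈I)
        (≤-trans (length-mono-⊆ (Unique.filter⁺ (y ~?_) uS) sub) deg)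
        where
        -- As `I` is stable, `y` has all its neighbours in `J`, so its degree into `J` is its full
        -- degree.
        sub : neighbours G y S ⊆ neighbours G y J
        sub p = let v∈S , y~v = ∈-neighbours⁻ G S p in
                ∈-filter⁺ (y ~?_) (∈-∖⁺ {ys = I} v∈S (λ v∈I → sI y∈I v∈I y~v)) y~v

-- Translation between subsets and duplicate-free lists.

open import Data.Fin.Subset using (_⊆_)

elements : ∀ {n} → Subset n → List (Fin n)
elements []            = []
elements (inside  ∷ p) = zero ∷ map suc (elements p)
elements (outside ∷ p) = map suc (elements p)

length-elements : ∀ {n} (p : Subset n) → length (elements p) ≡ ∣ p ∣
length-elements []            = refl
length-elements (inside  ∷ p) = cong suc (trans (length-map suc (elements p)) (length-elements p))
length-elements (outside ∷ p) = trans (length-map suc (elements p)) (length-elements p)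

elements-unique : ∀ {n} (p : Subset n) → Unique (elements p)
elements-unique []            = []
elements-unique (inside  ∷ p) = Unique-∷ zero∉ (Unique.map⁺ suc-injective (elements-unique p))
  where
  zero∉ : zero ∉ map suc (elements p)
  zero∉ q with ∈-map⁻ suc q
  ... | _ , _ , ()
elements-unique (outside ∷ p) = Unique.map⁺ suc-injective (elements-unique p)

∈-elements⁺ : ∀ {n v} {p : Subset n} → v ∈ˢ p → v ∈ elements p
∈-elements⁺ {p = inside  ∷ p} Vec.here      = here refl
∈-elements⁺ {p = inside  ∷ p} (Vec.there q) = there (∈-map⁺ suc (∈-elements⁺ q))
∈-elements⁺ {p = outside ∷ p} (Vec.there q) = ∈-map⁺ suc (∈-elements⁺ q)

∈-elements⁻ : ∀ {n v} (p : Subset n) → v ∈ elements p → v ∈ˢ p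
∈-elements⁻ (inside ∷ p) (here refl) = Vec.here
∈-elements⁻ (inside ∷ p) (there q) with ∈-map⁻ suc q
... | _ , r , refl = Vec.there (∈-elements⁻ p r)
∈-elements⁻ (outside ∷ p) q with ∈-map⁻ suc q
... | _ , r , refl = Vec.there (∈-elements⁻ p r)

module _ {n : ℕ} where
  open DecMembership (_≟ꟳ_ {n}) using (_∈?_)

  fromList : List (Fin n) → Subset n
  fromList L = Vec.tabulate (λ v → does (v ∈? L))

  ∈-fromList⁺ : ∀ {v L} → v ∈ L → v ∈ˢ fromList L
  ∈-fromList⁺ {v} {L} v∈L = lookup⇒[]= v _ (trans (lookup∘tabulate _ v) (dec-true (v ∈? L) v∈L))

  ∈-fromList⁻ : ∀ {v L} → v ∈ˢ fromList L → v ∈ L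
  ∈-fromList⁻ {v} {L} p with v ∈? L | trans (sym (lookup∘tabulate (λ v → does (v ∈? L)) v)) ([]=⇒lookup p)
  ... | yes v∈L | _ = v∈L
  ... | no  _   | ()

-- Passage from an arbitrary finite graph to a decidable good one.

theorem1p3 : (k n : ℕ) (G : Graph n) →
    ((S : Subset n) → Σ (Subset n) λ Y → Y ⊆ S × ∣ Y ∣ ≤ k × HalfStable G (S ─ Y)) →
    ColourableWith G (k + 2)
theorem1p3 k n G h =
  let c , proper = good⇒colourable k (length (allFin n)) G′ ≤-refl (Unique.allFin⁺ n) good
  in c , λ u v uv → proper (∈-allFin u) (∈-allFin v) (adjacent uv)
  where
  open Colour (_≟ꟳ_ {n})

  -- Adj need not be decidable, so we colour the decidable supergraph G′ in which u and v are
  -- non-adjacent only if u = v or one of the independent sets supplied by h contains both.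
  chosen : Subset n → Subset n
  chosen S = let _ , _ , _ , I , _ = h S in I

  Together : Fin n → Fin n → Set
  Together u v = ∃ λ S → u ∈ˢ chosen S × v ∈ˢ chosen S

  G′ : DecGraph (Fin n)
  G′ = record
    { _~_   = λ u v → u ≢ v × ¬ Together u v
    ; _~?_  = λ u v → ¬? (u ≟ꟳ v) ×-dec ¬? (anySubset? (λ S → (u ∈ˢ? chosen S) ×-dec (v ∈ˢ? chosen S)))
    ; ~-sym = λ (u≢v , apart) → (u≢v ∘ sym) , λ (S , p , q) → apart (S , q , p)
    ; ~-irr = λ (v≢v , _) → v≢v refl
    }

  adjacent : ∀ {u v} → Adj G u v → DecGraph._~_ G′ u v
  adjacent {u} {v} uv = (λ where refl → irrefl G u uv) , λ (S , p , q) →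
    let _ , _ , _ , _ , _ , independent , _ = h S in independent u v p q uv

  -- The independent set chosen for `H` is stable in `G′` by construction, and `eq` identifies `I`
  -- with it. Splitting `H` into its part in `Y` and the half-stable remainder gives the bound.
  good : Good G′ k (allFin n)
  good H uH _ with h (fromList H) in eq
  ... | Y , _ , Y≤k , I , I⊆ , _ , S≤ =
    elements I , elements-unique I ,
    (λ p → ∈-fromList⁻ (p─q⊆p (fromList H) Y (I⊆ (∈-elements⁻ I p)))) ,
    (λ p q (_ , apart) → apart (fromList H , inChosen p , inChosen q)) ,
    (begin
      length H                                                    ≤⟨ length-mono-⊆ uH cover ⟩
      length (elements Y ++ elements (fromList H ─ Y))            ≡⟨ length-++ (elements Y) ⟩
      length (elements Y) + length (elements (fromList H ─ Y))    ≡⟨ cong₂ _+_ (length-elements Y) (length-elements (fromList H ─ Y)) ⟩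
      ∣ Y ∣ + ∣ fromList H ─ Y ∣                                   ≤⟨ +-mono-≤ Y≤k S≤ ⟩
      k + (∣ I ∣ + (∣ I ∣ + 0))                                    ≡⟨ cong (λ i → k + (∣ I ∣ + i)) (+-identityʳ ∣ I ∣) ⟩
      k + (∣ I ∣ + ∣ I ∣)                                          ≡⟨ cong (λ i → k + (i + i)) (length-elements I) ⟨
      k + (length (elements I) + length (elements I))             ∎)
    where
    open ≤-Reasoning
    inChosen : ∀ {v} → v ∈ elements I → v ∈ˢ chosen (fromList H)
    inChosen {v} p = subst (λ r → v ∈ˢ proj₁ (proj₂ (proj₂ (proj₂ r)))) (sym eq) (∈-elements⁻ I p)
    cover : ∀ {v} → v ∈ H → v ∈ elements Y ++ elements (fromList H ─ Y)
    cover {v} v∈H with v ∈ˢ? Y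
    ... | yes v∈Y = ∈-++⁺ˡ (∈-elements⁺ v∈Y)
    ... | no  v∉Y = ∈-++⁺ʳ (elements Y) (∈-elements⁺ (x∈p∧x∉q⇒x∈p─q (∈-fromList⁺ v∈H) v∉Y))
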